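{- The structures $\langle\mathcal P(\omega)/\mathrm{Fin},\sigma\rangle$ and $\langle\mathcal P(\omega)/\mathrm{Fin},\sigma^{ -1}\rangle$ satisfy the same sentences of the infinitary logic $\mathcal L_{\omega_1,\omega_1}$ in the language of dynamical systems.
   Context: $\mathcal P(\omega)/\mathrm{Fin}$ is $\mathcal P(\omega)$ modulo finite sets, $\sigma([A])=[A+1]$ the shift. The language of dynamical systems has constants $\mathbf 0,\mathbf 1$, binary operations for join, meet and difference, the relation $\le$, and unary function symbols interpreted as an automorphism and its inverse. $\mathcal L_{\omega_1,\omega_1}$ allows countable conjunctions/disjunctions and quantification over countably many variables at once. -}

module Defs where

open import Data.Nat using (ℕ; zero; suc; _≥_)
open import Data.Bool using (Bool; true; false; if_then_else_; _∨_; _∧_; not)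
open import Data.Product using (Σ; ∃; _×_; _,_)
open import Data.Sum using (_⊎_)
open import Data.Empty using (⊥)
open import Relation.Nullary using (¬_)
open import Relation.Binary.PropositionalEquality using (_≡_)

-- P(ω) and P(ω)/Fin (as a setoid: representatives modulo finite sets)

Pω : Set
Pω = ℕ → Bool

_=*_ : Pω → Pω → Set
A =* B = ∃ λ n → ∀ m → m ≥ n → A m ≡ B m

_≤*_ : Pω → Pω → Set
A ≤* B = ∃ λ n → ∀ m → m ≥ n → A m ≡ true → B m ≡ true

-- Boolean operations on representatives (they respect =*).
∅ω fullω : Pω
∅ω _ = false
fullω _ = true

_∪ω_ _∩ω_ _∖ω_ : Pω → Pω → Pω
(A ∪ω B) m = A m ∨ B m
(A ∩ω B) m = A m ∧ B m
(A ∖ω B) m = A m ∧ not (B m)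

σ : Pω → Pω
σ A zero    = false
σ A (suc m) = A m

-- Its inverse on P(ω)/Fin: σ⁻¹([A]) = [A - 1] = [{ a : a + 1 ∈ A }].
σ⁻¹ : Pω → Pω
σ⁻¹ A m = A (suc m)

data Term : Set where
  var          : ℕ → Term
  𝟎 𝟏          : Term
  _⊔_ _⊓_ _∸'_ : Term → Term → Term
  aut aut⁻¹    : Term → Term

-- Formulas of L_{ω₁,ω₁}: atomic (= and ≤), negation, countable
-- conjunctions / disjunctions (indexed by ℕ; finite ones by repetition),
-- and universal / existential quantification over a countable block of
-- variables at once (the block is a subset S ⊆ ℕ of variable indices).
data Formula : Set where
  _≐_ _≼_   : Term → Term → Formula
  ¬'        : Formula → Formula
  ⋀ ⋁       : (ℕ → Formula) → Formula
  ∀' ∃'     : (ℕ → Bool) → Formula → Formula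

data OccursT (x : ℕ) : Term → Set where
  here  : OccursT x (var x)
  ⊔ˡ    : ∀ {t s} → OccursT x t → OccursT x (t ⊔ s)
  ⊔ʳ    : ∀ {t s} → OccursT x s → OccursT x (t ⊔ s)
  ⊓ˡ    : ∀ {t s} → OccursT x t → OccursT x (t ⊓ s)
  ⊓ʳ    : ∀ {t s} → OccursT x s → OccursT x (t ⊓ s)
  ∸ˡ    : ∀ {t s} → OccursT x t → OccursT x (t ∸' s)
  ∸ʳ    : ∀ {t s} → OccursT x s → OccursT x (t ∸' s)
  autᵒ  : ∀ {t} → OccursT x t → OccursT x (aut t)
  aut⁻¹ᵒ : ∀ {t} → OccursT x t → OccursT x (aut⁻¹ t)

data FreeIn (x : ℕ) : Formula → Set where
  ≐ˡ : ∀ {t s} → OccursT x t → FreeIn x (t ≐ s)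
  ≐ʳ : ∀ {t s} → OccursT x s → FreeIn x (t ≐ s)
  ≼ˡ : ∀ {t s} → OccursT x t → FreeIn x (t ≼ s)
  ≼ʳ : ∀ {t s} → OccursT x s → FreeIn x (t ≼ s)
  ¬ᶠ : ∀ {φ} → FreeIn x φ → FreeIn x (¬' φ)
  ⋀ᶠ : ∀ {φ} n → FreeIn x (φ n) → FreeIn x (⋀ φ)
  ⋁ᶠ : ∀ {φ} n → FreeIn x (φ n) → FreeIn x (⋁ φ)
  ∀ᶠ : ∀ {S φ} → S x ≡ false → FreeIn x φ → FreeIn x (∀' S φ)
  ∃ᶠ : ∀ {S φ} → S x ≡ false → FreeIn x φ → FreeIn x (∃' S φ)

Sentence : Formula → Set
Sentence φ = ∀ x → ¬ FreeIn x φ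

-- Semantics in ⟨P(ω)/Fin, f⟩, where f interprets `aut` and g interprets
-- `aut⁻¹`.  Elements are represented by subsets of ω; the atomic
-- relations are =* and ≤*, so everything is computed in the quotient.

Assignment : Set
Assignment = ℕ → Pω

override : (ℕ → Bool) → Assignment → Assignment → Assignment
override S τ ρ x = if S x then τ x else ρ x

module Semantics (f g : Pω → Pω) where

  evalT : Term → Assignment → Pω
  evalT (var x)   ρ = ρ x
  evalT 𝟎         ρ = ∅ω
  evalT 𝟏         ρ = fullω
  evalT (t ⊔ s)   ρ = evalT t ρ ∪ω evalT s ρ
  evalT (t ⊓ s)   ρ = evalT t ρ ∩ω evalT s ρ
  evalT (t ∸' s)  ρ = evalT t ρ ∖ω evalT s ρ
  evalT (aut t)   ρ = f (evalT t ρ)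
  evalT (aut⁻¹ t) ρ = g (evalT t ρ)

  Sat : Formula → Assignment → Set
  Sat (t ≐ s)   ρ = evalT t ρ =* evalT s ρ
  Sat (t ≼ s)   ρ = evalT t ρ ≤* evalT s ρ
  Sat (¬' φ)    ρ = ¬ Sat φ ρ
  Sat (⋀ φ)     ρ = ∀ n → Sat (φ n) ρ
  Sat (⋁ φ)     ρ = Σ ℕ λ n → Sat (φ n) ρ
  Sat (∀' S φ)  ρ = (τ : Assignment) → Sat φ (override S τ ρ)
  Sat (∃' S φ)  ρ = Σ Assignment λ τ → Sat φ (override S τ ρ)

_⊨σ_ : Assignment → Formula → Set
ρ ⊨σ φ = Semantics.Sat σ σ⁻¹ φ ρ

_⊨σ⁻¹_ : Assignment → Formula → Set
ρ ⊨σ⁻¹ φ = Semantics.Sat σ⁻¹ σ φ ρ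

-- The empty (irrelevant, for sentences) assignment.
ρ₀ : Assignment
ρ₀ _ _ = false

-- The ambient metatheory (ZFC) is classical.
LEM : Set₁
LEM = (P : Set) → P ⊎ ¬ P

{-# OPTIONS --safe #-}
-- A countable tuple of elements of P(ω)/Fin is an ω-word, read upwards for σ and downwards for
-- σ⁻¹.  Give finite words their rank-i Ehrenfeucht–Fraïssé types (a move recolours the word);
-- these are finite in number and compatible with concatenation.  By a diagonal Ramsey argument an
-- ω-word is cut into blocks such that from the i-th block on all blocks have the same rank-i type.
-- Two ω-words are matched when they have cuts with the same sequence of types; the order in which
-- the blocks are read is then irrelevant, since eventually, up to any given rank, a word is a
-- power of one element.  If one of the words is recoloured, cut it again homogeneously and answer
-- block by block, the a-th block at rank a.  So matching is a back-and-forth relation for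
-- countably many variables at once.
module Submission where

open import Defs
open import Data.Bool using (Bool; true; false; not; if_then_else_; _∨_; _∧_)
open import Data.Empty using (⊥-elim)
open import Data.Fin as Fin using (Fin; zero; suc; combine; funToFin; punchOut)
open import Data.Fin.Properties as Finₚ using (combine-injective; finToFun-funToFin; punchOut-injective)
open import Data.List using (List; []; _∷_; [_]; _++_; map; length; head; last; reverse; cartesianProductWith)
open import Data.List.Membership.Propositional using (_∈_)
open import Data.List.Membership.Propositional.Properties using (∈-++⁺ˡ; ∈-++⁺ʳ; ∈-map⁺; ∈-cartesianProductWith⁺)
open import Data.List.Properties using (map-++; length-map; ∷-injective; length-++; length-reverse; reverse-++; reverse-map; reverse-involutive; reverse-injective; unfold-reverse; ++-assoc; ++-identityʳ)
open import Data.List.Relation.Unary.All as All using (All; []; _∷_)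
open import Data.List.Relation.Unary.Any using (here; there)
open import Data.Maybe using (Maybe; just; nothing; maybe′; _<∣>_)
open import Data.Maybe.Relation.Binary.Pointwise as Pointwise using (Pointwise; just; nothing)
open import Data.Nat as ℕ using (ℕ; zero; suc; _+_; _*_; _^_; _∸_; _≤_; _<_; z≤n; s≤s; _≤′_; ≤′-refl; ≤′-step)
open import Data.Nat.Properties
open import Data.Product using (Σ; _×_; _,_; proj₁; proj₂)
open import Data.Sum using (_⊎_; inj₁; inj₂; [_,_]′)
open import Function using (_∘_; id)
open import Relation.Nullary using (yes; no)
open import Relation.Binary using (tri<; tri≈; tri>)
open import Relation.Binary.PropositionalEquality using (_≡_; _≢_; refl; sym; trans; cong; cong₂; subst; subst₂)

-- Increasing sequences and finite colourings.

Increasing : (ℕ → ℕ) → Set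
Increasing h = ∀ n → h n < h (suc n)

increasing-≤ : ∀ {h} → Increasing h → ∀ {a b} → a ≤ b → h a ≤ h b
increasing-≤ {h} inc = go ∘ ≤⇒≤′
  where
  go : ∀ {a b} → a ≤′ b → h a ≤ h b
  go ≤′-refl     = ≤-refl
  go (≤′-step p) = ≤-trans (go p) (<⇒≤ (inc _))

increasing-< : ∀ {h} → Increasing h → ∀ {a b} → a < b → h a < h b
increasing-< inc a<b = <-≤-trans (inc _) (increasing-≤ inc a<b)

increasing-id : ∀ {h} → Increasing h → ∀ n → n ≤ h n
increasing-id inc zero    = z≤n
increasing-id inc (suc n) = ≤-<-trans (increasing-id inc n) (inc n)

-- Equal colours imply `R`, with no converse, so `R` may be one-sided, such as an implication
-- between properties of `a` and `b`.
FiniteIndex : {A : Set} → (A → A → Set) → Set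
FiniteIndex {A} R = Σ ℕ λ N → Σ (A → Fin N) λ c → ∀ {a b} → c a ≡ c b → R a b

finiteIndex-∩ : {A : Set} {R S : A → A → Set} → FiniteIndex R → FiniteIndex S →
                FiniteIndex (λ a b → R a b × S a b)
finiteIndex-∩ (M , c , r) (N , d , s) =
  M * N , (λ a → combine (c a) (d a)) ,
  λ eq → let p , q = combine-injective _ _ _ _ eq in r p , s q

finiteIndex-All : {A I : Set} {R : I → A → A → Set} → (∀ i → FiniteIndex (R i)) →
                  ∀ is → FiniteIndex (λ a b → All (λ i → R i a b) is)
finiteIndex-All fi []       = 1 , (λ _ → zero) , λ _ → []
finiteIndex-All fi (i ∷ is) =
  let N , c , s = finiteIndex-∩ (fi i) (finiteIndex-All fi is)
  in N , c , λ eq → let p , ps = s eq in p ∷ ps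

finiteIndex-on : {A B : Set} {R : B → B → Set} (f : A → B) →
                 FiniteIndex R → FiniteIndex (λ a b → R (f a) (f b))
finiteIndex-on f (N , c , s) = N , c ∘ f , s

module _ (lem : LEM) where

  truthValue : Set → Fin 2
  truthValue P = [ (λ _ → suc zero) , (λ _ → zero) ]′ (lem P)

  truthValue-≡ : ∀ {P Q} → truthValue P ≡ truthValue Q → P → Q
  truthValue-≡ {P} {Q} eq p with lem P | lem Q
  ... | _       | inj₁ q  = q
  ... | inj₂ ¬p | inj₂ ¬q = ⊥-elim (¬p p)

  finiteIndex-⇒ : {A : Set} (P : A → Set) → FiniteIndex (λ a b → P a → P b)
  finiteIndex-⇒ P = 2 , truthValue ∘ P , truthValue-≡

  -- The new colour of `a` is the set of old colours occurring in its image under `S`, coded as one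
  -- of the `2 ^ N` subsets of `Fin N`.
  finiteIndex-image : {A B : Set} (S : A → B → Set) {R : B → B → Set} → FiniteIndex R →
    FiniteIndex (λ a a′ → ∀ {b} → S a b → Σ B λ b′ → S a′ b′ × R b b′)
  finiteIndex-image {A} {B} S {R} (N , c , s) =
    2 ^ N , (λ a → funToFin (bits a)) , λ {a} {a′} → sound {a} {a′}
    where
    Hit : A → Fin N → Set
    Hit a k = Σ B λ b → S a b × c b ≡ k
    bits : A → Fin N → Fin 2
    bits a k = truthValue (Hit a k)
    sound : ∀ {a a′} → funToFin (bits a) ≡ funToFin (bits a′) →
            ∀ {b} → S a b → Σ B λ b′ → S a′ b′ × R b b′
    sound {a} {a′} eq {b} sab =
      let same = trans (sym (finToFun-funToFin (bits a) (c b)))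
                   (trans (cong (λ k → Fin.finToFun k (c b)) eq) (finToFun-funToFin (bits a′) (c b)))
          b′ , sab′ , e = truthValue-≡ same (b , sab , refl)
      in b′ , sab′ , s (sym e)

  -- Monochromatic subsequences.

  -- Induction on the number of colours: either `zero` is avoided from some bound on and can be
  -- deleted from the palette, or it recurs beyond every bound and its occurrences can be listed.
  pigeonhole : ∀ {N} (f : ℕ → Fin N) →
               Σ (ℕ → ℕ) λ h → Increasing h × (∀ a b → f (h a) ≡ f (h b))
  pigeonhole {zero}  f with () ← f 0
  pigeonhole {suc N} f with lem (Σ ℕ λ B → ∀ b → B ≤ b → zero ≢ f b)
  ... | inj₁ (B , avoid) =
    let apart n = avoid (B + n) (m≤m+n B n)
        h , inc , const = pigeonhole (punchOut ∘ apart)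
    in (λ n → B + h n) , (λ n → +-monoʳ-< B (inc n)) ,
       λ a b → punchOut-injective (apart (h a)) (apart (h b)) (const a b)
  ... | inj₂ ¬avoid = h , (λ n → proj₁ (proj₂ (pick (suc (h n))))) ,
                      λ a b → trans (sym (hits a)) (hits b)
    where
    pick : ∀ B → Σ ℕ λ b → B ≤ b × zero ≡ f b
    pick B with lem (Σ ℕ λ b → B ≤ b × zero ≡ f b)
    ... | inj₁ found = found
    ... | inj₂ none  = ⊥-elim (¬avoid (B , λ b B≤b e → none (b , B≤b , e)))
    h : ℕ → ℕ
    h zero    = proj₁ (pick 0)
    h (suc n) = proj₁ (pick (suc (h n)))
    hits : ∀ n → zero ≡ f (h n)
    hits zero    = proj₂ (proj₂ (pick 0))
    hits (suc n) = proj₂ (proj₂ (pick (suc (h n))))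

  -- Thin out once for each `m`, so that `f m` is constant along `H (suc m)`. For `m < a` the
  -- sequence `H a` is a subsequence of `H (suc m)`, so the diagonal enters it after stage `m`.
  diagonal : {N : ℕ → ℕ} (f : ∀ m → ℕ → Fin (N m)) →
             Σ (ℕ → ℕ) λ h → Increasing h × (∀ {m a b} → m < a → m < b → f m (h a) ≡ f m (h b))
  diagonal {N} f = (λ a → H a a) , increasing , λ {m} m<a m<b → trans (at m<a) (sym (at m<b))
    where
    nested : ℕ → Σ (ℕ → ℕ) Increasing
    H : ℕ → ℕ → ℕ
    H m = proj₁ (nested m)
    sub : ∀ m → Σ (ℕ → ℕ) λ k → Increasing k × (∀ a b → f m (H m (k a)) ≡ f m (H m (k b)))
    sub m = pigeonhole (f m ∘ H m)
    nested zero    = id , λ n → ≤-refl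
    nested (suc m) = H m ∘ proj₁ (sub m) ,
                     λ n → increasing-< (proj₂ (nested m)) (proj₁ (proj₂ (sub m)) n)
    increasing : Increasing (λ a → H a a)
    increasing a = increasing-< (proj₂ (nested a)) (increasing-id (proj₁ (proj₂ (sub a))) (suc a))
    factor : ∀ {m a} → m ≤′ a → ∀ x → Σ ℕ λ c → H a x ≡ H m c
    factor ≤′-refl           x = x , refl
    factor (≤′-step {a} m≤a) x = factor m≤a (proj₁ (sub a) x)
    at : ∀ {m a} → m < a → f m (H a a) ≡ f m (H (suc m) 0)
    at {m} {a} m<a =
      let c , e = factor (≤⇒≤′ m<a) a
      in trans (cong (f m) e) (proj₂ (proj₂ (sub m)) c 0)

-- Letters, finite lists of terms, and local similarity of words.

-- A letter records the truth values of all terms at one position.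
Letter : Set
Letter = Term → Bool

Word : Set
Word = List Letter

-- Rank `suc i` looks only at the terms in `terms i`. A finite list keeps the number of types
-- finite, and every term comes into view at some rank.
terms : ℕ → List Term
terms zero    = []
terms (suc n) =
  T ++ (var n ∷ 𝟎 ∷ 𝟏 ∷ []) ++ map aut T ++ map aut⁻¹ T
    ++ cartesianProductWith _⊔_ T T ++ cartesianProductWith _⊓_ T T ++ cartesianProductWith _∸'_ T T
  where T = terms n

terms-mono : ∀ {m n t} → m ≤ n → t ∈ terms m → t ∈ terms n
terms-mono = go ∘ ≤⇒≤′
  where
  go : ∀ {m n t} → m ≤′ n → t ∈ terms m → t ∈ terms n
  go ≤′-refl       t∈ = t∈
  go (≤′-step m≤n) t∈ = ∈-++⁺ˡ (go m≤n t∈)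

terms-exhaustive : ∀ t → Σ ℕ λ n → t ∈ terms n
terms-exhaustive (var x) = suc x , ∈-++⁺ʳ (terms x) (here refl)
terms-exhaustive 𝟎 = 1 , there (here refl)
terms-exhaustive 𝟏 = 1 , there (there (here refl))
terms-exhaustive (aut s) =
  let n , s∈ = terms-exhaustive s
  in suc n , ∈-++⁺ʳ (terms n) (there (there (there (∈-++⁺ˡ (∈-map⁺ aut s∈)))))
terms-exhaustive (aut⁻¹ s) =
  let n , s∈ = terms-exhaustive s
  in suc n , ∈-++⁺ʳ (terms n) (there (there (there (∈-++⁺ʳ (map aut (terms n)) (∈-++⁺ˡ (∈-map⁺ aut⁻¹ s∈))))))
terms-exhaustive (s ⊔ u) =
  let m , s∈ = terms-exhaustive s
      n , u∈ = terms-exhaustive u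
      k = m ℕ.⊔ n
  in suc k , ∈-++⁺ʳ (terms k) (there (there (there (∈-++⁺ʳ (map aut (terms k)) (∈-++⁺ʳ (map aut⁻¹ (terms k))
       (∈-++⁺ˡ (∈-cartesianProductWith⁺ _⊔_ (terms-mono (m≤m⊔n m n) s∈) (terms-mono (m≤n⊔m m n) u∈))))))))
terms-exhaustive (s ⊓ u) =
  let m , s∈ = terms-exhaustive s
      n , u∈ = terms-exhaustive u
      k = m ℕ.⊔ n
  in suc k , ∈-++⁺ʳ (terms k) (there (there (there (∈-++⁺ʳ (map aut (terms k)) (∈-++⁺ʳ (map aut⁻¹ (terms k))
       (∈-++⁺ʳ (cartesianProductWith _⊔_ (terms k) (terms k))
       (∈-++⁺ˡ (∈-cartesianProductWith⁺ _⊓_ (terms-mono (m≤m⊔n m n) s∈) (terms-mono (m≤n⊔m m n) u∈)))))))))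
terms-exhaustive (s ∸' u) =
  let m , s∈ = terms-exhaustive s
      n , u∈ = terms-exhaustive u
      k = m ℕ.⊔ n
  in suc k , ∈-++⁺ʳ (terms k) (there (there (there (∈-++⁺ʳ (map aut (terms k)) (∈-++⁺ʳ (map aut⁻¹ (terms k))
       (∈-++⁺ʳ (cartesianProductWith _⊔_ (terms k) (terms k))
       (∈-++⁺ʳ (cartesianProductWith _⊓_ (terms k) (terms k))
       (∈-cartesianProductWith⁺ _∸'_ (terms-mono (m≤m⊔n m n) s∈) (terms-mono (m≤n⊔m m n) u∈)))))))))

terms-cover : ∀ ts → Σ ℕ λ n → All (_∈ terms n) ts
terms-cover []       = 0 , []
terms-cover (t ∷ ts) =
  let m , t∈  = terms-exhaustive t
      n , ts∈ = terms-cover ts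
  in m ℕ.⊔ n , terms-mono (m≤m⊔n m n) t∈ ∷ All.map (terms-mono (m≤n⊔m m n)) ts∈

AgreeOn : List Term → Letter → Letter → Set
AgreeOn ts l m = All (λ t → l t ≡ m t) ts

agree-refl : ∀ ts {l} → AgreeOn ts l l
agree-refl ts = All.tabulate λ _ → refl

agree-sym : ∀ {ts l m} → AgreeOn ts l m → AgreeOn ts m l
agree-sym = All.map sym

agree-trans : ∀ {ts l m n} → AgreeOn ts l m → AgreeOn ts m n → AgreeOn ts l n
agree-trans p q = All.zipWith (λ (e , f) → trans e f) (p , q)

data Adjacent (l l′ : Letter) : Word → Set where
  here  : ∀ {w} → Adjacent l l′ (l ∷ l′ ∷ w)
  there : ∀ {m w} → Adjacent l l′ w → Adjacent l l′ (m ∷ w)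

head-++ : (w v : Word) → head (w ++ v) ≡ (head w <∣> head v)
head-++ []      v = refl
head-++ (_ ∷ _) v = refl

last-++ : (w v : Word) → last (w ++ v) ≡ (last v <∣> last w)
last-++ []          v       = sym (<∣>-nothing (last v))
  where
  <∣>-nothing : (x : Maybe Letter) → (x <∣> nothing) ≡ x
  <∣>-nothing nothing  = refl
  <∣>-nothing (just _) = refl
last-++ (l ∷ [])    []      = refl
last-++ (l ∷ [])    (m ∷ v) = trans (last-++ [] (m ∷ v)) (nonempty m v)
  where
  nonempty : ∀ m v → (last (m ∷ v) <∣> nothing) ≡ (last (m ∷ v) <∣> just l)
  nonempty m []       = refl
  nonempty m (m′ ∷ v) = nonempty m′ v
last-++ (l ∷ l′ ∷ w) v      = last-++ (l′ ∷ w) v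

adjacent-++ˡ : ∀ {l l′ w} v → Adjacent l l′ w → Adjacent l l′ (w ++ v)
adjacent-++ˡ v here      = here
adjacent-++ˡ v (there p) = there (adjacent-++ˡ v p)

adjacent-++ʳ : ∀ {l l′} w {v} → Adjacent l l′ v → Adjacent l l′ (w ++ v)
adjacent-++ʳ []      p = p
adjacent-++ʳ (_ ∷ w) p = there (adjacent-++ʳ w p)

adjacent-++ᵐ : ∀ {l l′} w {v} → last w ≡ just l → head v ≡ just l′ → Adjacent l l′ (w ++ v)
adjacent-++ᵐ (_ ∷ [])      {_ ∷ _} refl refl = here
adjacent-++ᵐ (_ ∷ l′ ∷ w) p    q    = there (adjacent-++ᵐ (l′ ∷ w) p q)

adjacent-++⁻ : ∀ {l l′} w {v} → Adjacent l l′ (w ++ v) →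
               Adjacent l l′ w ⊎ (last w ≡ just l × head v ≡ just l′) ⊎ Adjacent l l′ v
adjacent-++⁻ []                    p         = inj₂ (inj₂ p)
adjacent-++⁻ (_ ∷ [])      {_ ∷ _} here      = inj₂ (inj₁ (refl , refl))
adjacent-++⁻ (_ ∷ [])              (there p) = inj₂ (inj₂ p)
adjacent-++⁻ (_ ∷ _ ∷ w)           here      = inj₁ here
adjacent-++⁻ (_ ∷ l ∷ w)           (there p) with adjacent-++⁻ (l ∷ w) p
... | inj₁ q = inj₁ (there q)
... | inj₂ q = inj₂ q

adjacent-reverse : ∀ {l l′ w} → Adjacent l l′ w → Adjacent l′ l (reverse w)
adjacent-reverse {l} {l′} {_ ∷ _ ∷ w} here =
  subst (Adjacent l′ l) (sym (trans (unfold-reverse l (l′ ∷ w)) (cong (_++ [ l ]) (unfold-reverse l′ w))))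
    (adjacent-++ᵐ (reverse w ++ [ l′ ]) (last-++ (reverse w) [ l′ ]) refl)
adjacent-reverse {l} {l′} {m ∷ w} (there p) =
  subst (Adjacent l′ l) (sym (unfold-reverse m w)) (adjacent-++ˡ [ m ] (adjacent-reverse p))

-- Adjacent pairs decide whether one row is the shift of another. First and last letters are
-- compared because concatenation creates a new adjacent pair at the seam.
LocallySimilar : List Term → Word → Word → Set
LocallySimilar ts w v =
  Pointwise (AgreeOn ts) (head w) (head v) × Pointwise (AgreeOn ts) (last w) (last v) ×
  (∀ {p} → Adjacent (proj₁ p) (proj₂ p) w → Σ (Letter × Letter) λ q → Adjacent (proj₁ q) (proj₂ q) v ×
    AgreeOn ts (proj₁ p) (proj₁ q) × AgreeOn ts (proj₂ p) (proj₂ q))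

locallySimilar-refl : ∀ ts {w} → LocallySimilar ts w w
locallySimilar-refl ts =
  Pointwise.refl (agree-refl ts) , Pointwise.refl (agree-refl ts) ,
  λ p → _ , p , agree-refl ts , agree-refl ts

locallySimilar-trans : ∀ ts {w v u} → LocallySimilar ts w v → LocallySimilar ts v u → LocallySimilar ts w u
locallySimilar-trans ts (h , e , a) (h′ , e′ , a′) =
  Pointwise.trans agree-trans h h′ , Pointwise.trans agree-trans e e′ ,
  λ p → let _ , q , x , y   = a p
            _ , r , x′ , y′ = a′ q
        in _ , r , agree-trans x x′ , agree-trans y y′

pointwise-<∣> : {R : Letter → Letter → Set} {a b c d : Maybe Letter} →
                Pointwise R a b → Pointwise R c d → Pointwise R (a <∣> c) (b <∣> d)
pointwise-<∣> (just r) _ = just r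
pointwise-<∣> nothing  q = q

pointwise-just : ∀ {R : Letter → Letter → Set} {x y : Maybe Letter} {l} → x ≡ just l → Pointwise R x y →
                 Σ Letter λ m → y ≡ just m × R l m
pointwise-just refl (just r) = _ , refl , r

locallySimilar-++ : ∀ ts {w v w′ v′} → LocallySimilar ts w v → LocallySimilar ts w′ v′ →
                    LocallySimilar ts (w ++ w′) (v ++ v′)
locallySimilar-++ ts {w} {v} {w′} {v′} (h , e , a) (h′ , e′ , a′) =
  subst₂ (Pointwise (AgreeOn ts)) (sym (head-++ w w′)) (sym (head-++ v v′)) (pointwise-<∣> h h′) ,
  subst₂ (Pointwise (AgreeOn ts)) (sym (last-++ w w′)) (sym (last-++ v v′)) (pointwise-<∣> e′ e) ,
  adjacent
  where
  adjacent : ∀ {p} → Adjacent (proj₁ p) (proj₂ p) (w ++ w′) → Σ (Letter × Letter) λ q →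
    Adjacent (proj₁ q) (proj₂ q) (v ++ v′) × AgreeOn ts (proj₁ p) (proj₁ q) × AgreeOn ts (proj₂ p) (proj₂ q)
  adjacent p with adjacent-++⁻ w p
  ... | inj₁ q        = let _ , r , xy = a q in _ , adjacent-++ˡ v′ r , xy
  ... | inj₂ (inj₂ q) = let _ , r , xy = a′ q in _ , adjacent-++ʳ v r , xy
  ... | inj₂ (inj₁ (p₁ , p₂)) =
    let _ , q₁ , x = pointwise-just p₁ e
        _ , q₂ , y = pointwise-just p₂ h′
    in _ , adjacent-++ᵐ v q₁ q₂ , x , y

-- Ranked types of finite words.

Agreement : Word → Word → Term → Set
Agreement w w′ t = map (λ l → l t) w′ ≡ map (λ l → l t) w

-- The forth condition of a game in which a move recolours a whole word.
Extends : (Word → Word → Set) → List Term → Word → Word → Set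
Extends R ts w v = ∀ {w′} → length w′ ≡ length w → Σ Word λ v′ →
  length v′ ≡ length v × R w′ v′ × All (λ t → Agreement w w′ t → Agreement v v′ t) ts

infix 4 _≈[_]_
-- One-sided clauses appear in both directions for symmetry, and each rank includes the previous one
-- for monotonicity. Through `Agreement` the answer keeps every listed row that the move keeps; this
-- later preserves the variables outside a quantified block.
data _≈[_]_ : Word → ℕ → Word → Set where
  base : ∀ {w v} → w ≈[ 0 ] v
  step : ∀ {i w v} → w ≈[ i ] v →
         LocallySimilar (terms i) w v → LocallySimilar (terms i) v w →
         Extends _≈[ i ]_ (terms i) w v → Extends _≈[ i ]_ (terms i) v w → w ≈[ suc i ] v

≈-refl : ∀ i {w} → w ≈[ i ] w
≈-refl zero    = base
≈-refl (suc i) = step (≈-refl i) (locallySimilar-refl _) (locallySimilar-refl _) extends extends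
  where
  extends : ∀ {w} → Extends _≈[ i ]_ (terms i) w w
  extends eq = _ , eq , ≈-refl i , All.tabulate λ _ → id

≈-sym : ∀ {i w v} → w ≈[ i ] v → v ≈[ i ] w
≈-sym base             = base
≈-sym (step r l l′ e e′) = step (≈-sym r) l′ l e′ e

≈-trans : ∀ {i w v u} → w ≈[ i ] v → v ≈[ i ] u → w ≈[ i ] u
≈-trans base base = base
≈-trans {suc i} (step r l l′ e e′) (step s m m′ f f′) =
  step (≈-trans r s) (locallySimilar-trans _ l m) (locallySimilar-trans _ m′ l′) (compose e f) (compose f′ e′)
  where
  compose : ∀ {w v u} → Extends _≈[ i ]_ (terms i) w v → Extends _≈[ i ]_ (terms i) v u →
            Extends _≈[ i ]_ (terms i) w u
  compose e f n =
    let _ , n′ , r , a = e n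
        _ , n″ , s , b = f n′
    in _ , n″ , ≈-trans r s , All.zipWith (λ (g , h) → h ∘ g) (a , b)

≈-mono : ∀ {i j w v} → i ≤ j → w ≈[ j ] v → w ≈[ i ] v
≈-mono = go ∘ ≤⇒≤′
  where
  go : ∀ {i j w v} → i ≤′ j → w ≈[ j ] v → w ≈[ i ] v
  go ≤′-refl       r                = r
  go (≤′-step i≤j) (step r _ _ _ _) = go i≤j r

split-length : {A B : Set} (xs : List A) (w v : List B) → length xs ≡ length (w ++ v) → Σ (List A) λ ys → Σ (List A) λ zs →
               xs ≡ ys ++ zs × length ys ≡ length w × length zs ≡ length v
split-length xs       []      v n = [] , xs , refl , refl , n
split-length (x ∷ xs) (_ ∷ w) v n =
  let ys , zs , e , m , k = split-length xs w v (suc-injective n)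
  in x ∷ ys , zs , cong (x ∷_) e , cong suc m , k

++-injective : {A : Set} (xs ys : List A) {xs′ ys′ : List A} → length xs ≡ length ys →
               xs ++ xs′ ≡ ys ++ ys′ → xs ≡ ys × xs′ ≡ ys′
++-injective []       []       n e = refl , e
++-injective (x ∷ xs) (y ∷ ys) n e =
  let p , q = ++-injective xs ys (suc-injective n) (proj₂ (∷-injective e))
  in cong₂ _∷_ (proj₁ (∷-injective e)) p , q

agreement-++ : ∀ {w v w′ v′ t} → Agreement w w′ t → Agreement v v′ t → Agreement (w ++ v) (w′ ++ v′) t
agreement-++ {w} {v} {w′} {v′} p q = trans (map-++ _ w′ v′) (trans (cong₂ _++_ p q) (sym (map-++ _ w v)))

agreement-++⁻ : ∀ {w v w′ v′ t} → length w′ ≡ length w → Agreement (w ++ v) (w′ ++ v′) t →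
                Agreement w w′ t × Agreement v v′ t
agreement-++⁻ {w} {v} {w′} {v′} n e =
  ++-injective (map _ w′) (map _ w) (trans (length-map _ w′) (trans n (sym (length-map _ w))))
    (trans (sym (map-++ _ w′ v′)) (trans e (map-++ _ w v)))

-- A move on a concatenation splits at the length of the first factor into a move on each factor.
-- The two answers are concatenated, and a row is kept on the whole exactly when it is kept on both
-- factors.
≈-++ : ∀ {i w v w′ v′} → w ≈[ i ] v → w′ ≈[ i ] v′ → w ++ w′ ≈[ i ] v ++ v′
≈-++ base base = base
≈-++ {suc i} (step r l l′ e e′) (step s m m′ f f′) =
  step (≈-++ r s) (locallySimilar-++ _ l m) (locallySimilar-++ _ l′ m′) (compose e f) (compose e′ f′)
  where
  compose : ∀ {w v w′ v′} → Extends _≈[ i ]_ (terms i) w v → Extends _≈[ i ]_ (terms i) w′ v′ →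
            Extends _≈[ i ]_ (terms i) (w ++ w′) (v ++ v′)
  compose {w} {v} {w′} {v′} e f {u} n with split-length u w w′ n
  ... | x , x′ , refl , k , k′ =
    let y  , j  , r , a = e k
        y′ , j′ , s , b = f k′
    in y ++ y′ , trans (length-++ y) (trans (cong₂ _+_ j j′) (sym (length-++ v))) , ≈-++ r s ,
       All.zipWith (λ {t} (g , h) p →
         let p₁ , p₂ = agreement-++⁻ {w} {w′} {x} {x′} {t} k p
         in agreement-++ {v} {v′} {y} {y′} {t} (g p₁) (h p₂)) (a , b)

-- Finiteness of the set of types, and homogeneous cuts.

module _ (lem : LEM) where

  agreeOn-finiteIndex : ∀ ts → FiniteIndex (AgreeOn ts)
  agreeOn-finiteIndex = finiteIndex-All λ t → 2 , (λ l → bit (l t)) , bit-injective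
    where
    bit : Bool → Fin 2
    bit true  = zero
    bit false = suc zero
    bit-injective : ∀ {a b} → bit a ≡ bit b → a ≡ b
    bit-injective {true}  {true}  _ = refl
    bit-injective {false} {false} _ = refl

  locallySimilar-finiteIndex : ∀ ts → FiniteIndex (LocallySimilar ts)
  locallySimilar-finiteIndex ts =
    finiteIndex-∩ (finiteIndex-on head maybe-finiteIndex) (finiteIndex-∩ (finiteIndex-on last maybe-finiteIndex)
      (finiteIndex-image lem (λ w e → Adjacent (proj₁ e) (proj₂ e) w)
        (finiteIndex-∩ (finiteIndex-on proj₁ agreement) (finiteIndex-on proj₂ agreement))))
    where
    agreement = agreeOn-finiteIndex ts
    maybe-finiteIndex : FiniteIndex (Pointwise (AgreeOn ts))
    maybe-finiteIndex = let N , c , s = agreement in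
      suc N , maybe′ (suc ∘ c) zero ,
      λ { {just _}  {just _}  eq → just (s (Finₚ.suc-injective eq))
        ; {nothing} {nothing} eq → nothing }

  -- Besides the previous type and the local data, only finitely many bits matter: which rank `i`
  -- types recolourings can have, and which rows of `terms i` such recolourings keep.
  ≈-finiteIndex : ∀ i → FiniteIndex _≈[ i ]_
  ≈-finiteIndex zero    = 1 , (λ _ → zero) , λ _ → base
  ≈-finiteIndex (suc i) =
    let N , c , s = finiteIndex-∩ (≈-finiteIndex i) (finiteIndex-∩ (locallySimilar-finiteIndex (terms i)) recolourings)
    in N , c , λ {w} {v} eq →
         let r , l  , e  = s eq
             -- The colouring yields one-sided clauses; reversing the equation of colours supplies
             -- the other halves.
             _ , l′ , e′ = s (sym eq)
         in step r l l′ (extends e) (extends e′)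
    where
    -- The original word is carried along, because the kept rows depend on it as well as on the
    -- recolouring.
    Recolouring : Word → Word × Word → Set
    Recolouring w (u , w′) = u ≡ w × length w′ ≡ length w
    Similar : Word × Word → Word × Word → Set
    Similar (w , w′) (v , v′) = w′ ≈[ i ] v′ × All (λ t → Agreement w w′ t → Agreement v v′ t) (terms i)
    recolourings : FiniteIndex (λ w v → ∀ {p} → Recolouring w p → Σ (Word × Word) λ q → Recolouring v q × Similar p q)
    recolourings = finiteIndex-image lem Recolouring
      (finiteIndex-∩ (finiteIndex-on proj₂ (≈-finiteIndex i))
        (finiteIndex-All (λ t → finiteIndex-⇒ lem λ (w , w′) → Agreement w w′ t) (terms i)))
    extends : ∀ {w v} → (∀ {p} → Recolouring w p → Σ (Word × Word) λ q → Recolouring v q × Similar p q) →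
              Extends _≈[ i ]_ (terms i) w v
    extends e n with e (refl , n)
    ... | (_ , v′) , (refl , n′) , r , a = v′ , n′ , r , a

  -- Ramsey's theorem for consecutive blocks only, for all ranks at once: along h every
  -- V a (h b) has a limit type D a, and along a subsequence these limit types converge.
  homogeneous : (V : ℕ → ℕ → Word) → Σ (ℕ → ℕ) λ q → Increasing q × 0 < q 0 ×
    (∀ {i a b} → i ≤ a → i ≤ b → V (q a) (q (suc a)) ≈[ i ] V (q b) (q (suc b)))
  homogeneous V = q , increasing , 0<q , homog
    where
    class : ∀ i → Word → Fin (proj₁ (≈-finiteIndex i))
    class i = proj₁ (proj₂ (≈-finiteIndex i))
    sound : ∀ i {w v} → class i w ≡ class i v → w ≈[ i ] v
    sound i = proj₂ (proj₂ (≈-finiteIndex i))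
    limit = diagonal lem λ m b → class m (V m b)
    h = proj₁ limit
    D : ℕ → Word
    D a = V a (h (suc a))
    limit′ = diagonal lem λ i a → class i (D (h a))
    k = proj₁ limit′
    k-increasing = proj₁ (proj₂ limit′)
    g : ℕ → ℕ
    g a = h (k a)
    g-increasing : Increasing g
    g-increasing a = increasing-< (proj₁ (proj₂ limit)) (k-increasing a)
    -- The index `l (suc a)` exceeds `q a`, so `q (suc a)` lies far enough along `h` for the block
    -- from `q a` to have its limit type `D (q a)`. Starting at 1 gives `a < l a`, which the
    -- convergence of the limit types at all ranks up to `a` requires.
    l : ℕ → ℕ
    l zero    = 1
    l (suc a) = suc (g (l a))
    q : ℕ → ℕ
    q a = g (l a)
    l-increasing : Increasing l
    l-increasing a = s≤s (increasing-id g-increasing (l a))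
    <-l : ∀ a → a < l a
    <-l zero    = ≤-refl
    <-l (suc a) = ≤-<-trans (<-l a) (l-increasing a)
    increasing : Increasing q
    increasing a = increasing-< g-increasing (l-increasing a)
    0<q : 0 < q 0
    0<q = increasing-id g-increasing 1
    toLimit : ∀ {i a} → i ≤ a → V (q a) (q (suc a)) ≈[ i ] D (q a)
    toLimit {i} {a} i≤a = ≈-mono (≤-trans i≤a (increasing-id increasing a))
      (sound (q a) (proj₂ (proj₂ limit) (increasing-id k-increasing (suc (q a))) ≤-refl))
    homog : ∀ {i a b} → i ≤ a → i ≤ b → V (q a) (q (suc a)) ≈[ i ] V (q b) (q (suc b))
    homog {i} {a} {b} i≤a i≤b = ≈-trans (toLimit i≤a) (≈-trans
      (sound i (proj₂ (proj₂ limit′) (≤-<-trans i≤a (<-l a)) (≤-<-trans i≤b (<-l b))))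
      (≈-sym (toLimit i≤b)))

-- Segments of ω-words and gluing.

segment : (ℕ → Letter) → ℕ → ℕ → Word
segment X p zero    = []
segment X p (suc n) = X p ∷ segment X (suc p) n

length-segment : ∀ X p n → length (segment X p n) ≡ n
length-segment X p zero    = refl
length-segment X p (suc n) = cong suc (length-segment X (suc p) n)

segment-+ : ∀ X p m n → segment X p (m + n) ≡ segment X p m ++ segment X (p + m) n
segment-+ X p zero    n = cong (λ q → segment X q n) (sym (+-identityʳ p))
segment-+ X p (suc m) n = cong (X p ∷_)
  (trans (segment-+ X (suc p) m n) (cong (λ q → segment X (suc p) m ++ segment X q n) (sym (+-suc p m))))

segment-cong : ∀ {X Y} p n → (∀ r → p ≤ r → r < p + n → X r ≡ Y r) → segment X p n ≡ segment Y p n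
segment-cong p zero    e = refl
segment-cong p (suc n) e = cong₂ _∷_ (e p ≤-refl (m<m+n p (s≤s z≤n)))
  (segment-cong (suc p) n λ r p<r r< → e r (<⇒≤ p<r) (subst (r <_) (sym (+-suc p n)) r<))

segment-agreement : ∀ {X Y t} p n → (∀ r → p ≤ r → X r t ≡ Y r t) →
                    map (λ l → l t) (segment X p n) ≡ map (λ l → l t) (segment Y p n)
segment-agreement p zero    e = refl
segment-agreement p (suc n) e = cong₂ _∷_ (e p ≤-refl) (segment-agreement (suc p) n λ r p<r → e r (<⇒≤ p<r))

segment-agreement⁻ : ∀ {X Y t} p n → map (λ l → l t) (segment X p n) ≡ map (λ l → l t) (segment Y p n) →
                     ∀ {r} → p ≤ r → r < p + n → X r t ≡ Y r t
segment-agreement⁻ p zero    e p≤r r< = ⊥-elim (<⇒≱ r< (subst (_≤ _) (sym (+-identityʳ p)) p≤r))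
segment-agreement⁻ p (suc n) e {r} p≤r r< with m≤n⇒m<n∨m≡n p≤r
... | inj₁ p<r  = segment-agreement⁻ (suc p) n (proj₂ (∷-injective e)) p<r (subst (r <_) (+-suc p n) r<)
... | inj₂ refl = proj₁ (∷-injective e)

adjacent-segment⁺ : ∀ X p n {r} → p ≤ r → suc r < p + n → Adjacent (X r) (X (suc r)) (segment X p n)
adjacent-segment⁺ X p zero          p≤r r< = ⊥-elim (<⇒≱ r< (subst (_≤ _) (sym (+-identityʳ p)) (m≤n⇒m≤1+n p≤r)))
adjacent-segment⁺ X p (suc n) {r}   p≤r r< with m≤n⇒m<n∨m≡n p≤r
adjacent-segment⁺ X p (suc n) {r}   p≤r r< | inj₁ p<r =
  there (adjacent-segment⁺ X (suc p) n p<r (subst (suc r <_) (+-suc p n) r<))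
adjacent-segment⁺ X p (suc zero)    p≤r r< | inj₂ refl = ⊥-elim (<-irrefl (+-comm 1 p) r<)
adjacent-segment⁺ X p (suc (suc n)) p≤r r< | inj₂ refl = here

adjacent-segment⁻ : ∀ {X l l′} p n → Adjacent l l′ (segment X p n) →
                    Σ ℕ λ r → p ≤ r × l ≡ X r × l′ ≡ X (suc r)
adjacent-segment⁻ p (suc (suc n)) here      = p , ≤-refl , refl , refl
adjacent-segment⁻ p (suc n)       (there a) =
  let r , p<r , e = adjacent-segment⁻ (suc p) n a in r , <⇒≤ p<r , e

write : ℕ → Word → ℕ → Letter
write p []      r = λ _ → false
write p (l ∷ w) r with r ≟ p
... | yes _ = l
... | no  _ = write (suc p) w r

segment-write : ∀ p w → segment (write p w) p (length w) ≡ w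
segment-write p []      = refl
segment-write p (l ∷ w) with p ≟ p
... | yes _  = cong (l ∷_) (trans (segment-cong (suc p) (length w) λ r p<r _ → later r p<r) (segment-write (suc p) w))
  where
  later : ∀ r → p < r → write p (l ∷ w) r ≡ write (suc p) w r
  later r p<r with r ≟ p
  ... | yes refl = ⊥-elim (<-irrefl refl p<r)
  ... | no  _    = refl
... | no p≢p = ⊥-elim (p≢p refl)

locate : ∀ {s} → Increasing s → ∀ j {m} → s j ≤ m → Σ ℕ λ b → j ≤ b × s b ≤ m × m < s (suc b)
-- The fuel `suc m` suffices, since `s (j + suc m)` is at least `j + suc m` and hence exceeds `m`.
locate {s} inc j {m} sj≤m = go (suc m) j ≤-refl sj≤m (≤-trans (m≤n+m (suc m) j) (increasing-id inc (j + suc m)))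
  where
  go : ∀ c a → j ≤ a → s a ≤ m → m < s (a + c) → Σ ℕ λ b → j ≤ b × s b ≤ m × m < s (suc b)
  go zero    a j≤a sa≤m m< = ⊥-elim (<⇒≱ m< (subst (λ z → s z ≤ m) (sym (+-identityʳ a)) sa≤m))
  go (suc c) a j≤a sa≤m m< with s (suc a) ≤? m
  ... | yes s≤m = go c (suc a) (m≤n⇒m≤1+n j≤a) s≤m (subst (λ z → m < s z) (+-suc a c) m<)
  ... | no  s≰m = a , j≤a , sa≤m , ≰⇒> s≰m

locate-unique : ∀ {s a b m} → Increasing s → s a ≤ m → m < s (suc a) → s b ≤ m → m < s (suc b) → a ≡ b
locate-unique {s} {a} {b} inc a≤ <a b≤ <b with <-cmp a b
... | tri< a<b _ _ = ⊥-elim (<⇒≱ <a (≤-trans (increasing-≤ inc a<b) b≤))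
... | tri≈ _ a≡b _ = a≡b
... | tri> _ _ b<a = ⊥-elim (<⇒≱ <b (≤-trans (increasing-≤ inc b<a) a≤))

glue : ∀ {s} → Increasing s → (ℕ → ℕ → Letter) → ℕ → Letter
glue {s} inc W m with s 0 ≤? m
... | yes s≤m = W (proj₁ (locate inc 0 s≤m)) m
-- Only finitely many positions precede the first cut, so any letters will do there.
... | no  _   = W 0 m

glue-block : ∀ {s} (inc : Increasing s) W {a m} → s a ≤ m → m < s (suc a) → glue inc W m ≡ W a m
glue-block {s} inc W {a} {m} sa≤m m< with s 0 ≤? m
... | yes s≤m = let b , _ , sb≤m , m<b = locate inc 0 s≤m
                in cong (λ c → W c m) (locate-unique inc sb≤m m<b sa≤m m<)
... | no  s≰m = ⊥-elim (s≰m (≤-trans (increasing-≤ inc z≤n) sa≤m))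

-- Reading upwards and downwards.

-- In the direction true, positions are read upwards and aut is the shift σ;
-- in the direction false, positions are read downwards and aut is σ⁻¹.
read : Bool → (ℕ → Letter) → ℕ → ℕ → Word
read true  X p n = segment X p n
read false X p n = reverse (segment X p n)

length-read : ∀ d X p n → length (read d X p n) ≡ n
length-read true  X p n = length-segment X p n
length-read false X p n = trans (length-reverse (segment X p n)) (length-segment X p n)

read-cong : ∀ d {X Y} p n → (∀ r → p ≤ r → r < p + n → X r ≡ Y r) → read d X p n ≡ read d Y p n
read-cong true  p n e = segment-cong p n e
read-cong false p n e = cong reverse (segment-cong p n e)

read-agreement : ∀ d {X Y t} p n → (∀ r → p ≤ r → X r t ≡ Y r t) → Agreement (read d Y p n) (read d X p n) t
read-agreement true          p n e = segment-agreement p n e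
read-agreement false {X} {Y} p n e =
  trans (reverse-map _ (segment X p n)) (trans (cong reverse (segment-agreement p n e)) (sym (reverse-map _ (segment Y p n))))

read-agreement⁻ : ∀ d {X Y t} p n → Agreement (read d Y p n) (read d X p n) t →
                  ∀ {r} → p ≤ r → r < p + n → X r t ≡ Y r t
read-agreement⁻ true          p n e = segment-agreement⁻ p n e
read-agreement⁻ false {X} {Y} p n e = segment-agreement⁻ p n
  (reverse-injective (trans (sym (reverse-map _ (segment X p n))) (trans e (reverse-map _ (segment Y p n)))))

writeIn : Bool → ℕ → Word → ℕ → Letter
writeIn true  p w = write p w
writeIn false p w = write p (reverse w)

read-writeIn : ∀ d p w → read d (writeIn d p w) p (length w) ≡ w
read-writeIn true  p w = segment-write p w
read-writeIn false p w =
  trans (cong (λ n → reverse (segment (write p (reverse w)) p n)) (sym (length-reverse w)))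
    (trans (cong reverse (segment-write p (reverse w))) (reverse-involutive w))

-- Because the pair is taken in reading order, one relation between neighbouring letters can express
-- the law of `aut` in both structures.
Holds : Bool → (Letter → Letter → Set) → (ℕ → Letter) → ℕ → Set
Holds true  R X r = R (X r) (X (suc r))
Holds false R X r = R (X (suc r)) (X r)

holds-adjacent : ∀ d X p n {r} → p ≤ r → suc r < p + n → Holds d (λ l m → Adjacent l m (read d X p n)) X r
holds-adjacent true  X p n p≤r r< = adjacent-segment⁺ X p n p≤r r<
holds-adjacent false X p n p≤r r< = adjacent-reverse (adjacent-segment⁺ X p n p≤r r<)

holds-map : ∀ d {R S : Letter → Letter → Set} {X r} → (∀ {l m} → R l m → S l m) → Holds d R X r → Holds d S X r
holds-map true  f = f
holds-map false f = f

adjacent-holds : ∀ d {R X p n} → (∀ r → p ≤ r → Holds d R X r) → ∀ {l m} → Adjacent l m (read d X p n) → R l m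
adjacent-holds true  {p = p} {n} h a with adjacent-segment⁻ p n a
... | r , p≤r , refl , refl = h r p≤r
adjacent-holds false {X = X} {p} {n} h a
  with adjacent-segment⁻ p n (subst (Adjacent _ _) (reverse-involutive (segment X p n)) (adjacent-reverse a))
... | r , p≤r , refl , refl = h r p≤r

-- Groups of blocks and matched ω-words.

block : Bool → (ℕ → Letter) → (ℕ → ℕ) → ℕ → ℕ → Word
block d X t a b = read d X (t a) (t b ∸ t a)

segment-split : ∀ X {p q r} → p ≤ q → q ≤ r →
                segment X p (r ∸ p) ≡ segment X p (q ∸ p) ++ segment X q (r ∸ q)
segment-split X {p} {q} {r} p≤q q≤r =
  trans (cong (segment X p) lengths)
    (trans (segment-+ X p (q ∸ p) (r ∸ q)) (cong (λ z → segment X p (q ∸ p) ++ segment X z (r ∸ q)) (m+[n∸m]≡n p≤q)))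
  where
  lengths : r ∸ p ≡ (q ∸ p) + (r ∸ q)
  lengths = trans (cong (_∸ p) (sym (m+[n∸m]≡n q≤r))) (+-∸-comm (r ∸ q) p≤q)

power : Word → ℕ → Word
power e zero    = []
power e (suc n) = e ++ power e n

power-comm : ∀ e n → power e n ++ e ≡ e ++ power e n
power-comm e zero    = sym (++-identityʳ e)
power-comm e (suc n) = trans (++-assoc e (power e n) e) (cong (e ++_) (power-comm e n))

-- Reading downwards also reverses the order of the blocks. As all of them have the type of the
-- single word `e`, and `e` commutes with its powers, the order is invisible at rank `i`.
block-power : ∀ d {X t i e} → Increasing t → (∀ {b} → i ≤ b → block d X t b (suc b) ≈[ i ] e) →
              ∀ {a} → i ≤ a → ∀ n → block d X t a (a + n) ≈[ i ] power e n
block-power d {X} {t} {i} {e} inc similar {a} i≤a zero =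
  subst (_≈[ i ] []) (sym (trans (cong (read d X (t a)) (trans (cong (λ b → t b ∸ t a) (+-identityʳ a)) (n∸n≡0 (t a)))) (empty d))) (≈-refl i)
  where
  empty : ∀ d → read d X (t a) 0 ≡ []
  empty true  = refl
  empty false = refl
block-power d {X} {t} {i} {e} inc similar {a} i≤a (suc n) =
  subst (λ b → block d X t a b ≈[ i ] power e (suc n)) (sym (+-suc a n)) (join d (similar i≤a)
    (block-power d inc similar (m≤n⇒m≤1+n i≤a) n))
  where
  split : segment X (t a) (t (suc a + n) ∸ t a) ≡
          segment X (t a) (t (suc a) ∸ t a) ++ segment X (t (suc a)) (t (suc a + n) ∸ t (suc a))
  split = segment-split X (<⇒≤ (inc a)) (increasing-≤ inc (m≤m+n (suc a) n))
  join : ∀ d → block d X t a (suc a) ≈[ i ] e → block d X t (suc a) (suc a + n) ≈[ i ] power e n →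
         block d X t a (suc a + n) ≈[ i ] e ++ power e n
  join true  r s = subst (_≈[ i ] _) (sym split) (≈-++ r s)
  -- Here the first block is read last, which gives `power e n ++ e`.
  join false r s = subst₂ _≈[ i ]_
    (sym (trans (cong reverse split) (reverse-++ (segment X (t a) (t (suc a) ∸ t a)) _))) (power-comm e n) (≈-++ s r)

-- The indices in `match` vary independently, so it also makes the late blocks of each side
-- equivalent among themselves.
record Matched (d d′ : Bool) (X Y : ℕ → Letter) : Set where
  field
    cutˡ cutʳ   : ℕ → ℕ
    increasingˡ : Increasing cutˡ
    increasingʳ : Increasing cutʳ
    match       : ∀ {i a b} → i ≤ a → i ≤ b → block d X cutˡ a (suc a) ≈[ i ] block d′ Y cutʳ b (suc b)

  -- Both groups are compared with the `n`-th power of one word, block `i` of `Y`; hence they may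
  -- start at different indices.
  match-groups : ∀ {i a b} → i ≤ a → i ≤ b → ∀ n → block d X cutˡ a (a + n) ≈[ i ] block d′ Y cutʳ b (b + n)
  match-groups i≤a i≤b n = ≈-trans
    (block-power d increasingˡ (λ i≤c → match i≤c ≤-refl) i≤a n)
    (≈-sym (block-power d′ increasingʳ (λ i≤c → ≈-trans (≈-sym (match ≤-refl i≤c)) (match ≤-refl ≤-refl)) i≤b n))

matched-sym : ∀ {d d′ X Y} → Matched d d′ X Y → Matched d′ d Y X
matched-sym M = record
  { cutˡ = cutʳ ; cutʳ = cutˡ ; increasingˡ = increasingʳ ; increasingʳ = increasingˡ
  ; match = λ i≤a i≤b → ≈-sym (match i≤b i≤a) }
  where open Matched M

-- Transfer of laws and of moves between matched words.

Eventually : (ℕ → Set) → Set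
Eventually P = Σ ℕ λ N → ∀ m → N ≤ m → P m

SupportedBy : List Term → (Letter → Letter → Set) → Set
SupportedBy ts R = ∀ {l l′ m m′} → AgreeOn ts l m → AgreeOn ts l′ m′ → R l l′ → R m m′

-- A late adjacent pair of `Y` lies in a group of blocks of the same type as a group of `X` beyond
-- `N`. That group contains a pair agreeing with it on `ts`, and the law holds there.
matched-law : ∀ {d d′ X Y} → Matched d d′ X Y → ∀ ts {R} → SupportedBy ts R →
              Eventually (Holds d R X) → Eventually (Holds d′ R Y)
matched-law {d} {d′} {X} {Y} M ts {R} supported (N , law) = s (suc i) , λ m s≤m →
  let b , i<b , sb≤m , m<  = locate increasingʳ (suc i) s≤m
      -- Two blocks are grouped because the pair at `m` and `suc m` may straddle the cut
      -- `s (suc b)`.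
      m+1<   = subst (suc m <_) (sym (m+[n∸m]≡n (increasing-≤ increasingʳ (m≤m+n b 2))))
                 (≤-<-trans m< (subst (λ c → s (suc b) < s c) (+-comm 2 b) (increasingʳ (suc b))))
  in holds-map d′ (inBlock i<b) (holds-adjacent d′ Y (s b) (s (b + 2) ∸ s b) sb≤m m+1<)
  where
  open Matched M renaming (cutʳ to s)
  i = proj₁ (terms-cover ts)
  restrict : ∀ {l m} → AgreeOn (terms i) l m → AgreeOn ts l m
  restrict p = All.map (All.lookup p) (proj₂ (terms-cover ts))
  a = N ℕ.⊔ suc i
  inBlock : ∀ {b} → suc i ≤ b → ∀ {l m} → Adjacent l m (block d′ Y s b (b + 2)) → R l m
  inBlock i<b adj with match-groups (m≤n⊔m N (suc i)) i<b 2
  ... | step _ _ (_ , _ , find) _ _ =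
    let _ , adj′ , p , q = find adj
        law′ = λ r t≤r → law r (≤-trans (m≤m⊔n N (suc i)) (≤-trans (increasing-id increasingˡ a) t≤r))
    in supported (agree-sym (restrict p)) (agree-sym (restrict q)) (adjacent-holds d {R} law′ adj′)

-- The new cuts only have to follow X′: on both sides the old blocks are close to one
-- power of a fixed word, so any regrouping of them with growing ranks still matches.
matched-extend-along : ∀ {d d′ X Y} (M : Matched d d′ X Y) X′ {q} → Increasing q → 0 < q 0 →
  (∀ {i a b} → i ≤ a → i ≤ b →
    block d X′ (Matched.cutˡ M) (q a) (q (suc a)) ≈[ i ] block d X′ (Matched.cutˡ M) (q b) (q (suc b))) →
  Σ (ℕ → Letter) λ Y′ → Matched d d′ X′ Y′ ×
    (∀ t → Eventually (λ m → X′ m t ≡ X m t) → Eventually (λ m → Y′ m t ≡ Y m t))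
matched-extend-along {d} {d′} {X} {Y} M X′ {q} q-increasing 0<q homog = Y′ , matched , agreement
  where
  open Matched M
  <-q : ∀ a → a < q a
  <-q zero    = 0<q
  <-q (suc a) = ≤-<-trans (<-q a) (q-increasing a)
  t s : ℕ → ℕ
  t a = cutˡ (q a)
  s a = cutʳ (q a)
  t-increasing : Increasing t
  t-increasing a = increasing-< increasingˡ (q-increasing a)
  s-increasing : Increasing s
  s-increasing a = increasing-< increasingʳ (q-increasing a)
  -- The old block index `q a` is at least `suc a`, so rank `suc a` is available: one rank pays for
  -- the answer and `a` remains.
  similar : ∀ a → block d X t a (suc a) ≈[ suc a ] block d′ Y s a (suc a)
  similar a = subst (λ b → block d X cutˡ (q a) b ≈[ suc a ] block d′ Y cutʳ (q a) b)
    (m+[n∸m]≡n (<⇒≤ (q-increasing a))) (match-groups (<-q a) (<-q a) (q (suc a) ∸ q a))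
  extends : ∀ a → Extends _≈[ a ]_ (terms a) (block d X t a (suc a)) (block d′ Y s a (suc a))
  extends a with similar a
  ... | step _ _ _ e _ = e
  response : ∀ a → Σ Word λ v → length v ≡ length (block d′ Y s a (suc a)) × block d X′ t a (suc a) ≈[ a ] v ×
    All (λ u → Agreement (block d X t a (suc a)) (block d X′ t a (suc a)) u → Agreement (block d′ Y s a (suc a)) v u) (terms a)
  response a = extends a (trans (length-read d X′ _ _) (sym (length-read d X _ _)))
  v : ℕ → Word
  v a = proj₁ (response a)
  length-v : ∀ a → length (v a) ≡ s (suc a) ∸ s a
  length-v a = trans (proj₁ (proj₂ (response a))) (length-read d′ Y _ _)
  W : ℕ → ℕ → Letter
  W a = writeIn d′ (s a) (v a)
  Y′ : ℕ → Letter
  Y′ = glue s-increasing W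
  upper : ∀ a → s a + (s (suc a) ∸ s a) ≡ s (suc a)
  upper a = m+[n∸m]≡n (<⇒≤ (s-increasing a))
  block-Y′ : ∀ a → block d′ Y′ s a (suc a) ≡ v a
  block-Y′ a = trans
    (read-cong d′ (s a) (s (suc a) ∸ s a) λ r s≤r r< → glue-block s-increasing W s≤r (subst (r <_) (upper a) r<))
    (trans (cong (read d′ (W a) (s a)) (sym (length-v a))) (read-writeIn d′ (s a) (v a)))
  matched : Matched d d′ X′ Y′
  matched = record
    { cutˡ = t ; cutʳ = s ; increasingˡ = t-increasing ; increasingʳ = s-increasing
    ; match = λ {i} {a} {b} i≤a i≤b → ≈-trans (homog i≤a i≤b)
        (subst (block d X′ t b (suc b) ≈[ i ]_) (sym (block-Y′ b)) (≈-mono i≤b (proj₁ (proj₂ (proj₂ (response b)))))) }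
  agreement : ∀ u → Eventually (λ m → X′ m u ≡ X m u) → Eventually (λ m → Y′ m u ≡ Y m u)
  -- From block `j` on, positions are past `N` and the rank is high enough to see `u`, so the
  -- answers copy its row.
  agreement u (N , e) = s j , λ m s≤m →
    let b , j≤b , sb≤m , m< = locate s-increasing j s≤m
        e′ = read-agreement d {X′} {X} {u} (t b) (t (suc b) ∸ t b) λ r t≤r → e r
               (≤-trans (m≤m⊔n N i) (≤-trans j≤b (≤-trans (increasing-id t-increasing b) t≤r)))
        copied = All.lookup (proj₂ (proj₂ (proj₂ (response b)))) (terms-mono (≤-trans (m≤n⊔m N i) j≤b) u∈) e′
    in read-agreement⁻ d′ {Y′} {Y} {u} (s b) (s (suc b) ∸ s b)
         (subst (λ w → Agreement (block d′ Y s b (suc b)) w u) (sym (block-Y′ b)) copied)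
         sb≤m (subst (m <_) (sym (upper b)) m<)
    where
    i = proj₁ (terms-exhaustive u)
    u∈ = proj₂ (terms-exhaustive u)
    j = N ℕ.⊔ i

matched-extend : LEM → ∀ {d d′ X Y} → Matched d d′ X Y → ∀ X′ → Σ (ℕ → Letter) λ Y′ → Matched d d′ X′ Y′ ×
  (∀ t → Eventually (λ m → X′ m t ≡ X m t) → Eventually (λ m → Y′ m t ≡ Y m t))
matched-extend lem {d} M X′ =
  let _ , q-increasing , 0<q , homog = homogeneous lem (block d X′ (Matched.cutˡ M))
  in matched-extend-along M X′ q-increasing 0<q homog

-- Term values as columns of ω-words.

shift : Bool → Pω → Pω
shift true  = σ
shift false = σ⁻¹

evalT : Bool → Term → Assignment → Pω
evalT d = Semantics.evalT (shift d) (shift (not d))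

Sat : Bool → Formula → Assignment → Set
Sat d = Semantics.Sat (shift d) (shift (not d))

=*-sym : ∀ {A B} → A =* B → B =* A
=*-sym (N , e) = N , λ m N≤m → sym (e m N≤m)

=*-trans : ∀ {A B C} → A =* B → B =* C → A =* C
=*-trans (M , e) (N , f) = M ℕ.⊔ N , λ m ≤m →
  trans (e m (≤-trans (m≤m⊔n M N) ≤m)) (f m (≤-trans (m≤n⊔m M N) ≤m))

=*-cong₂ : ∀ (f : Bool → Bool → Bool) {A A′ B B′} → A =* A′ → B =* B′ →
           (λ m → f (A m) (B m)) =* (λ m → f (A′ m) (B′ m))
=*-cong₂ f (M , e) (N , e′) = M ℕ.⊔ N , λ m ≤m →
  cong₂ f (e m (≤-trans (m≤m⊔n M N) ≤m)) (e′ m (≤-trans (m≤n⊔m M N) ≤m))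

shift-cong : ∀ d {A B} → A =* B → shift d A =* shift d B
shift-cong true  (N , e) = suc N , λ { (suc m) (s≤s N≤m) → e m N≤m }
shift-cong false (N , e) = N , λ m N≤m → e (suc m) (m≤n⇒m≤1+n N≤m)

≤*-resp : ∀ {A A′ B B′} → A =* A′ → B =* B′ → A ≤* B → A′ ≤* B′
≤*-resp A=A′ B=B′ (N , le) =
  let M , e = A=A′
      K , f = B=B′
      L = M ℕ.⊔ K
  in L ℕ.⊔ N , λ m ≤m a →
       let L≤m = ≤-trans (m≤m⊔n L N) ≤m
       in trans (sym (f m (≤-trans (m≤n⊔m M K) L≤m)))
            (le m (≤-trans (m≤n⊔m L N) ≤m) (trans (e m (≤-trans (m≤m⊔n M K) L≤m)) a))

column : (ℕ → Letter) → Term → Pω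
column X t m = X m t

-- Laws of single letters become laws of pairs that ignore the second letter, so `matched-law`
-- covers Boolean identities too. Read downwards, the first letter of a pair is at the higher
-- position.
holds-pointwise : ∀ d (Q : Letter → Set) {X} → Eventually (Q ∘ X) → Eventually (Holds d (λ l _ → Q l) X)
holds-pointwise true  Q (N , e) = N , e
holds-pointwise false Q (N , e) = N , λ m N≤m → e (suc m) (m≤n⇒m≤1+n N≤m)

holds-pointwise⁻ : ∀ d (Q : Letter → Set) {X} → Eventually (Holds d (λ l _ → Q l) X) → Eventually (Q ∘ X)
holds-pointwise⁻ true  Q (N , e) = N , e
holds-pointwise⁻ false Q (N , e) = suc N , λ { (suc m) (s≤s N≤m) → e m N≤m }

matched-pointwise : ∀ {d d′ X Y} → Matched d d′ X Y → ∀ ts (Q : Letter → Set) →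
  (∀ {l m} → AgreeOn ts l m → Q l → Q m) → Eventually (Q ∘ X) → Eventually (Q ∘ Y)
matched-pointwise {d} {d′} M ts Q supported =
  holds-pointwise⁻ d′ Q ∘ matched-law M ts (λ p _ → supported p) ∘ holds-pointwise d Q

matched-operation : ∀ {d d′ X Y} → Matched d d′ X Y → ∀ (f : Bool → Bool → Bool) t s u →
  column X t =* (λ m → f (X m s) (X m u)) → column Y t =* (λ m → f (Y m s) (Y m u))
matched-operation M f t s u = matched-pointwise M (t ∷ s ∷ u ∷ []) (λ l → l t ≡ f (l s) (l u))
  λ { (p ∷ q ∷ r ∷ []) e → trans (sym p) (trans e (cong₂ f q r)) }

-- In reading order, `Successor` expresses `σ` upwards and `σ⁻¹` downwards; `Predecessor` expresses
-- the inverse.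
Successor Predecessor : Term → Term → Letter → Letter → Set
Successor   t s l l′ = l′ t ≡ l s
Predecessor t s l l′ = l t ≡ l′ s

shift-successor : ∀ d {X} t s → (∀ m → X m t ≡ shift d (column X s) m) → Eventually (Holds d (Successor t s) X)
shift-successor true  t s e = 0 , λ m _ → e (suc m)
shift-successor false t s e = 0 , λ m _ → e m

successor-shift : ∀ d {X} t s → Eventually (Holds d (Successor t s) X) → column X t =* shift d (column X s)
successor-shift true  t s (N , e) = suc N , λ { (suc m) (s≤s N≤m) → e m N≤m }
successor-shift false t s e       = e

shift-predecessor : ∀ d {X} t s → (∀ m → X m t ≡ shift (not d) (column X s) m) → Eventually (Holds d (Predecessor t s) X)
shift-predecessor true  t s e = 0 , λ m _ → e m
shift-predecessor false t s e = 0 , λ m _ → e (suc m)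

predecessor-shift : ∀ d {X} t s → Eventually (Holds d (Predecessor t s) X) → column X t =* shift (not d) (column X s)
predecessor-shift true  t s e       = e
predecessor-shift false t s (N , e) = suc N , λ { (suc m) (s≤s N≤m) → e m N≤m }

matched-aut : ∀ {d d′ X Y} → Matched d d′ X Y → ∀ t s →
  (∀ m → X m t ≡ shift d (column X s) m) → column Y t =* shift d′ (column Y s)
matched-aut {d} {d′} M t s e = successor-shift d′ t s (matched-law M (t ∷ s ∷ [])
  (λ { (_ ∷ p ∷ []) (q ∷ _ ∷ []) e → trans (sym q) (trans e p) }) (shift-successor d t s e))

matched-aut⁻¹ : ∀ {d d′ X Y} → Matched d d′ X Y → ∀ t s →
  (∀ m → X m t ≡ shift (not d) (column X s) m) → column Y t =* shift (not d′) (column Y s)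
matched-aut⁻¹ {d} {d′} M t s e = predecessor-shift d′ t s (matched-law M (t ∷ s ∷ [])
  (λ { (p ∷ _ ∷ []) (_ ∷ q ∷ []) e → trans (sym p) (trans e q) }) (shift-predecessor d t s e))

-- Similar assignments and satisfaction.

record Similar (d d′ : Bool) (ρ ρ′ : Assignment) : Set where
  field
    -- Glued answers represent term values only modulo finite sets, so the words are kept apart from
    -- the evaluations.
    X Y     : ℕ → Letter
    valuesˡ : ∀ t → column X t =* evalT d t ρ
    valuesʳ : ∀ t → column Y t =* evalT d′ t ρ′
    matched : Matched d d′ X Y

similar-sym : ∀ {d d′ ρ ρ′} → Similar d d′ ρ ρ′ → Similar d′ d ρ′ ρ
similar-sym R = record { X = Y ; Y = X ; valuesˡ = valuesʳ ; valuesʳ = valuesˡ ; matched = matched-sym matched }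
  where open Similar R

-- Induction on terms. A quantified variable is read off `Y′`, any other keeps its old column, and
-- for the remaining terms the defining law holds in `X′` and is transferred by matching.
matched-values : ∀ {d d′ ρ ρ′} (R : Similar d d′ ρ ρ′) S τ {Y′} →
  let X′ = λ m t → evalT d t (override S τ ρ) m in
  Matched d d′ X′ Y′ →
  (∀ t → column X′ t =* column (Similar.X R) t → column Y′ t =* column (Similar.Y R) t) →
  ∀ t → column Y′ t =* evalT d′ t (override S (λ x → column Y′ (var x)) ρ′)
matched-values {d} {d′} {ρ} {ρ′} R S τ {Y′} matched′ agreement = values
  where
  open Similar R
  X′ : ℕ → Letter
  X′ m t = evalT d t (override S τ ρ) m
  values : ∀ t → column Y′ t =* evalT d′ t (override S (λ x → column Y′ (var x)) ρ′)
  values (var x) with S x in Sx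
  ... | true  = 0 , λ _ _ → refl
  ... | false = =*-trans (agreement (var x) unchanged) (valuesʳ (var x))
    where
    unchanged : column X′ (var x) =* column X (var x)
    unchanged = let N , e = valuesˡ (var x) in
      N , λ m N≤m → trans (cong (λ b → (if b then τ x else ρ x) m) Sx) (sym (e m N≤m))
  values 𝟎        = matched-operation matched′ (λ _ _ → false) 𝟎 𝟎 𝟎 (0 , λ _ _ → refl)
  values 𝟏        = matched-operation matched′ (λ _ _ → true) 𝟏 𝟏 𝟏 (0 , λ _ _ → refl)
  values (t ⊔ s)  = =*-trans (matched-operation matched′ _∨_ (t ⊔ s) t s (0 , λ _ _ → refl))
                      (=*-cong₂ _∨_ (values t) (values s))
  values (t ⊓ s)  = =*-trans (matched-operation matched′ _∧_ (t ⊓ s) t s (0 , λ _ _ → refl))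
                      (=*-cong₂ _∧_ (values t) (values s))
  values (t ∸' s) = =*-trans (matched-operation matched′ (λ a b → a ∧ not b) (t ∸' s) t s (0 , λ _ _ → refl))
                      (=*-cong₂ (λ a b → a ∧ not b) (values t) (values s))
  values (aut t)   = =*-trans (matched-aut matched′ (aut t) t λ _ → refl) (shift-cong d′ (values t))
  values (aut⁻¹ t) = =*-trans (matched-aut⁻¹ matched′ (aut⁻¹ t) t λ _ → refl) (shift-cong (not d′) (values t))

similar-override : LEM → ∀ {d d′ ρ ρ′} → Similar d d′ ρ ρ′ → ∀ S τ →
                   Σ Assignment λ τ′ → Similar d d′ (override S τ ρ) (override S τ′ ρ′)
similar-override lem {d} {ρ = ρ} R S τ =
  let Y′ , matched′ , agreement = matched-extend lem (Similar.matched R) (λ m t → evalT d t (override S τ ρ) m)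
  in (λ x → column Y′ (var x)) , record
       { Y = Y′ ; valuesˡ = λ t → 0 , λ _ _ → refl ; valuesʳ = matched-values R S τ matched′ agreement
       ; matched = matched′ }

-- Induction on `φ`. A whole countable block costs a single move, since a letter records all
-- variables at once. Negation and `∀'` use the symmetry of similarity.
similar-sat : LEM → ∀ φ {d d′ ρ ρ′} → Similar d d′ ρ ρ′ → Sat d φ ρ → Sat d′ φ ρ′
similar-sat lem (t ≐ s) R e = =*-trans (=*-sym (valuesʳ t)) (=*-trans
  (matched-pointwise matched (t ∷ s ∷ []) (λ l → l t ≡ l s)
    (λ { (p ∷ q ∷ []) e → trans (sym p) (trans e q) })
    (=*-trans (valuesˡ t) (=*-trans e (=*-sym (valuesˡ s)))))
  (valuesʳ s))
  where open Similar R
similar-sat lem (t ≼ s) R le = ≤*-resp (valuesʳ t) (valuesʳ s)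
  (matched-pointwise matched (t ∷ s ∷ []) (λ l → l t ≡ true → l s ≡ true)
    (λ { (p ∷ q ∷ []) le e → trans (sym q) (le (trans p e)) })
    (≤*-resp (=*-sym (valuesˡ t)) (=*-sym (valuesˡ s)) le))
  where open Similar R
similar-sat lem (¬' φ) R ¬sat sat = ¬sat (similar-sat lem φ (similar-sym R) sat)
similar-sat lem (⋀ φ) R sat n = similar-sat lem (φ n) R (sat n)
similar-sat lem (⋁ φ) R (n , sat) = n , similar-sat lem (φ n) R sat
similar-sat lem (∀' S φ) R sat τ′ =
  let τ , R′ = similar-override lem (similar-sym R) S τ′
  in similar-sat lem φ (similar-sym R′) (sat τ)
similar-sat lem (∃' S φ) R (τ , sat) =
  let τ′ , R′ = similar-override lem R S τ
  in τ′ , similar-sat lem φ R′ sat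

-- Cut into single letters, a constant word looks the same in both directions.
matched-constant : ∀ d d′ l → Matched d d′ (λ _ → l) (λ _ → l)
matched-constant d d′ l = record
  { cutˡ = id ; cutʳ = id ; increasingˡ = λ _ → ≤-refl ; increasingʳ = λ _ → ≤-refl
  ; match = λ {i} {a} {b} _ _ → subst₂ _≈[ i ]_ (sym (single d a)) (sym (single d′ b)) (≈-refl i) }
  where
  single : ∀ d a → read d (λ _ → l) a (suc a ∸ a) ≡ [ l ]
  single d a = trans (cong (read d (λ _ → l) a) (m+n∸n≡m 1 a)) (singleton d)
    where
    singleton : ∀ d → read d (λ _ → l) a 1 ≡ [ l ]
    singleton true  = refl
    singleton false = refl

similar-ρ₀ : ∀ d d′ → Similar d d′ ρ₀ ρ₀
similar-ρ₀ d d′ = record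
  { X = λ _ → truth ; Y = λ _ → truth ; valuesˡ = values d ; valuesʳ = values d′ ; matched = matched-constant d d′ truth }
  where
  -- Under `ρ₀` every term is empty or full modulo finite sets, and both shifts fix these two
  -- classes.
  truth : Letter
  truth (var _)   = false
  truth 𝟎         = false
  truth 𝟏         = true
  truth (t ⊔ s)   = truth t ∨ truth s
  truth (t ⊓ s)   = truth t ∧ truth s
  truth (t ∸' s)  = truth t ∧ not (truth s)
  truth (aut t)   = truth t
  truth (aut⁻¹ t) = truth t
  shift-constant : ∀ d b → (λ _ → b) =* shift d (λ _ → b)
  shift-constant true  b = 1 , λ { (suc _) _ → refl }
  shift-constant false b = 0 , λ _ _ → refl
  values : ∀ d t → (λ _ → truth t) =* evalT d t ρ₀
  values d (var _)   = 0 , λ _ _ → refl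
  values d 𝟎         = 0 , λ _ _ → refl
  values d 𝟏         = 0 , λ _ _ → refl
  values d (t ⊔ s)   = =*-cong₂ _∨_ (values d t) (values d s)
  values d (t ⊓ s)   = =*-cong₂ _∧_ (values d t) (values d s)
  values d (t ∸' s)  = =*-cong₂ (λ a b → a ∧ not b) (values d t) (values d s)
  values d (aut t)   = =*-trans (shift-constant d (truth t)) (shift-cong d (values d t))
  values d (aut⁻¹ t) = =*-trans (shift-constant (not d) (truth t)) (shift-cong (not d) (values d t))

theorem12p2 : LEM → (φ : Formula) → Sentence φ →
    ((ρ₀ ⊨σ φ → ρ₀ ⊨σ⁻¹ φ) × (ρ₀ ⊨σ⁻¹ φ → ρ₀ ⊨σ φ))
theorem12p2 lem φ _ = similar-sat lem φ (similar-ρ₀ true false) , similar-sat lem φ (similar-ρ₀ false true)
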